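{- Let $G$ be a finite abelian group and let $D=\mathrm{Dih}(G)=\langle G,x\rangle$. Let $S\subseteq D$ be closed under inversion, and let $\Gamma=\mathrm{Cay}(D,S)$. Suppose that there exist an integer $k\ge 0$, an element $c\in G$ of order $2^k$ and a subgroup $A\le G$ such that $G$ is the internal direct product $G=\langle c\rangle\times A$. If there exists some $y\in xG$ such that for every $g\in G$ we have $yg\in S\cap xG$ if and only if $yg^{ -1}c\in S\cap xG$, then $\Gamma$ is a Cayley graph on the abelian group $C_{2^{k+1}}\times A$.
   Context: For a group $K$ and a subset $S\subseteq K$ closed under inversion ($S=S^{ -1}$), the Cayley graph $\mathrm{Cay}(K,S)$ is the (undirected) graph with vertex set $K$ in which $u$ and $v$ are adjacent if and only if $v=su$ for some $s\in S$. (The identity is usually omitted from $S$ to avoid loops.) A graph $\Gamma$ is said to be a Cayley graph on a group $K$ if $\Gamma$ is isomorphic to $\mathrm{Cay}(K,T)$ for some inverse-closed $T\subseteq K$; equivalently, $\mathrm{Aut}(\Gamma)$ contains a subgroup isomorphic to $K$ acting regularly on $V(\Gamma)$. For an abelian group $G$, the generalized dihedral group is $\mathrm{Dih}(G)=\langle G,x\rangle$, where $x\notin G$, $x^2=1$ and $gx=xg^{ -1}$ for every $g\in G$; that is, the semidirect product of $G$ with a group $\langle x\rangle$ of order $2$ acting by inversion, so that $G$ has index $2$ in $\mathrm{Dih}(G)$ and $xG$ is its other coset. $C_n$ denotes the cyclic group of order $n$. -}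

module Defs where

open import Level using (Level; 0ℓ; _⊔_; suc)
open import Algebra.Bundles using (Group; AbelianGroup; RawGroup)
open import Algebra.Morphism.Structures using (IsGroupMonomorphism)
import Algebra.Morphism.GroupMonomorphism as GroupMonomorphism
import Algebra.Properties.AbelianGroup as AbelianGroupProperties
import Algebra.Properties.Group as GroupProperties
import Algebra.Properties.Monoid.Mult as MonoidMult
open import Data.Integer.Base as ℤ using (ℤ; +_; -[1+_]; _⊖_)
open import Data.Integer.Divisibility.Signed using (_∣_; divides; ∣m∣n⇒∣m+n; ∣m⇒∣-m)
import Data.Integer.Properties as ℤₚ
open import Data.Integer.Tactic.RingSolver using (solve-∀)
open import Data.Nat.Base as ℕ using (ℕ; zero)
import Data.Nat.Properties as ℕₚ
open import Data.Parity.Base as ℙ using (Parity; 0ℙ; 1ℙ)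
import Data.Parity.Properties as ℙₚ
open import Data.Fin.Base using (Fin)
open import Data.Product.Base using (Σ-syntax; ∃; ∃-syntax; _×_; _,_; proj₁; proj₂)
open import Data.Product.Relation.Binary.Pointwise.NonDependent using (×-setoid)
open import Function.Base using (_on_; id)
open import Function.Bundles using (Bijection; Inverse; _⇔_)
open import Relation.Binary.Bundles using (Setoid)
open import Relation.Binary.Core using (Rel)
open import Relation.Binary.Definitions using (Symmetric; _Respects_; _Respects₂_)
open import Relation.Binary.PropositionalEquality.Core as ≡ using (_≡_)
import Relation.Binary.PropositionalEquality.Properties as ≡ₚ
import Relation.Binary.Reasoning.Setoid as SetoidReasoning
open import Relation.Unary using (Pred; _∈_)

private
  variable
    a ℓ p q s v e v′ ℓ′ e′ : Level

Finite : Setoid a ℓ → Set (a ⊔ ℓ)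
Finite A = ∃[ n ] Bijection (≡ₚ.setoid (Fin n)) A

-- Undirected, with loops allowed: connection sets below may contain the
-- identity.  Vertices are compared up to the setoid equality.
record Graph v ℓ e : Set (suc (v ⊔ ℓ ⊔ e)) where
  field
    vertices : Setoid v ℓ
  open Setoid vertices public using (_≈_) renaming (Carrier to Vertex)
  field
    Adj      : Rel Vertex e
    Adj-resp : Adj Respects₂ _≈_
    Adj-sym  : Symmetric Adj

record _≅_ (Γ : Graph v ℓ e) (Δ : Graph v′ ℓ′ e′) :
           Set (v ⊔ ℓ ⊔ e ⊔ v′ ⊔ ℓ′ ⊔ e′) where
  private
    module Γ = Graph Γ
    module Δ = Graph Δ
  field
    bijection : Inverse Γ.vertices Δ.vertices
  open Inverse bijection public using (to; from)
  field
    to-adj : ∀ u w → Γ.Adj u w ⇔ Δ.Adj (to u) (to w)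

module _ (K : Group a ℓ) where
  open Group K
  open GroupProperties K using (\\-leftDividesʳ)

  record InverseClosedSubset s : Set (a ⊔ ℓ ⊔ suc s) where
    field
      Member    : Pred Carrier s
      resp      : Member Respects _≈_
      ⁻¹-closed : ∀ {g} → g ∈ Member → g ⁻¹ ∈ Member

  Cay : InverseClosedSubset s → Graph a ℓ (a ⊔ ℓ ⊔ s)
  Cay S = record
    { vertices = setoid
    ; Adj      = λ u w → ∃[ t ] t ∈ Member × w ≈ t ∙ u
    ; Adj-resp = (λ w≈w′ (t , t∈S , w≈tu) → t , t∈S , trans (sym w≈w′) w≈tu)
               , (λ u≈u′ (t , t∈S , w≈tu) → t , t∈S , trans w≈tu (∙-congˡ u≈u′))
    ; Adj-sym  = λ {u} {w} (t , t∈S , w≈tu) → t ⁻¹ , ⁻¹-closed t∈S ,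
                   sym (trans (∙-congˡ w≈tu) (\\-leftDividesʳ t u))
    }
    where open InverseClosedSubset S

-- The universe level of T is no restriction beyond that of Γ: in Cay(K,T),
-- T is the set of neighbours of the identity.
IsCayleyGraphOn : Graph v ℓ e → Group a ℓ′ → Set (v ⊔ ℓ ⊔ suc e ⊔ a ⊔ ℓ′)
IsCayleyGraphOn {e = e} Γ K = Σ[ T ∈ InverseClosedSubset K e ] Γ ≅ Cay K T

record Subgroup (G : Group a ℓ) p : Set (a ⊔ ℓ ⊔ suc p) where
  open Group G
  field
    Member    : Pred Carrier p
    resp      : Member Respects _≈_
    ε-closed  : ε ∈ Member
    ∙-closed  : ∀ {g h} → g ∈ Member → h ∈ Member → g ∙ h ∈ Member
    ⁻¹-closed : ∀ {g} → g ∈ Member → g ⁻¹ ∈ Member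

module _ (G : AbelianGroup a ℓ) where
  private module G = AbelianGroup G

  subgroupAbelianGroup : Subgroup G.group p → AbelianGroup (a ⊔ p) ℓ
  subgroupAbelianGroup H = record
    { isAbelianGroup =
        GroupMonomorphism.isAbelianGroup proj₁-mono G.isAbelianGroup }
    where
    open Subgroup H
    raw : RawGroup _ _
    raw = record
      { Carrier = ∃ Member
      ; _≈_     = G._≈_ on proj₁
      ; _∙_     = λ (g , g∈H) (h , h∈H) → g G.∙ h , ∙-closed g∈H h∈H
      ; ε       = G.ε , ε-closed
      ; _⁻¹     = λ (g , g∈H) → g G.⁻¹ , ⁻¹-closed g∈H
      }
    proj₁-mono : IsGroupMonomorphism raw G.rawGroup proj₁
    proj₁-mono = record
      { isGroupHomomorphism = record
        { isMonoidHomomorphism = record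
          { isMagmaHomomorphism = record
            { isRelHomomorphism = record { cong = id }
            ; homo = λ _ _ → G.refl
            }
          ; ε-homo = G.refl
          }
        ; ⁻¹-homo = λ _ → G.refl
        }
      ; injective = id
      }

  -- Both factors are automatically normal, G being abelian.
  record IsInternalDirectProduct (H : Subgroup G.group p) (K : Subgroup G.group q) :
                                 Set (a ⊔ ℓ ⊔ p ⊔ q) where
    private
      module H = Subgroup H
      module K = Subgroup K
    field
      generate : ∀ g → ∃[ h ] ∃[ k ] h ∈ H.Member × k ∈ K.Member × g G.≈ h G.∙ k
      disjoint : ∀ {g} → g ∈ H.Member → g ∈ K.Member → g G.≈ G.ε

module _ (G : Group a ℓ) where
  open Group G
  open GroupProperties G
  open MonoidMult monoid using (×-homo-+) renaming (_×_ to _·_)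
  open SetoidReasoning setoid

  infixr 8 _^ℕ_ _^ℤ_

  -- The library's n-fold multiple n × g, in multiplicative notation.
  _^ℕ_ : Carrier → ℕ → Carrier
  g ^ℕ n = n · g

  _^ℤ_ : Carrier → ℤ → Carrier
  g ^ℤ (+ n)    = g ^ℕ n
  g ^ℤ -[1+ n ] = (g ^ℕ ℕ.suc n) ⁻¹

  record HasOrder (g : Carrier) (n : ℕ) : Set ℓ where
    field
      positive : 0 ℕ.< n
      power    : g ^ℕ n ≈ ε
      minimal  : ∀ m → 0 ℕ.< m → g ^ℕ m ≈ ε → n ℕ.≤ m

  private
    ^ℕ-comm : ∀ g n → g ∙ g ^ℕ n ≈ g ^ℕ n ∙ g
    ^ℕ-comm g zero      = trans (identityʳ g) (sym (identityˡ g))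
    ^ℕ-comm g (ℕ.suc n) = trans (∙-congˡ (^ℕ-comm g n)) (sym (assoc g _ g))

    ^ℕ-homo : ∀ g m n → g ^ℕ (m ℕ.+ n) ≈ g ^ℕ m ∙ g ^ℕ n
    ^ℕ-homo = ×-homo-+

  ^ℤ-homo-⊖ : ∀ g m n → g ^ℤ (m ⊖ n) ≈ g ^ℕ m ∙ (g ^ℕ n) ⁻¹
  ^ℤ-homo-⊖ g zero      zero      = sym (inverseʳ ε)
  ^ℤ-homo-⊖ g zero      (ℕ.suc n) = sym (identityˡ _)
  ^ℤ-homo-⊖ g (ℕ.suc m) zero      = sym (trans (∙-congˡ ε⁻¹≈ε) (identityʳ _))
  ^ℤ-homo-⊖ g (ℕ.suc m) (ℕ.suc n) = begin
    g ^ℤ (ℕ.suc m ⊖ ℕ.suc n)                  ≡⟨ ≡.cong (g ^ℤ_) (ℤₚ.[1+m]⊖[1+n]≡m⊖n m n) ⟩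
    g ^ℤ (m ⊖ n)                              ≈⟨ ^ℤ-homo-⊖ g m n ⟩
    g ^ℕ m ∙ (g ^ℕ n) ⁻¹                     ≈⟨ ∙-congʳ (//-rightDividesʳ g (g ^ℕ m)) ⟨
    g ^ℕ m ∙ g ∙ g ⁻¹ ∙ (g ^ℕ n) ⁻¹          ≈⟨ assoc _ _ _ ⟩
    g ^ℕ m ∙ g ∙ (g ⁻¹ ∙ (g ^ℕ n) ⁻¹)        ≈⟨ ∙-cong (^ℕ-comm g m) (⁻¹-anti-homo-∙ (g ^ℕ n) g) ⟨
    g ^ℕ ℕ.suc m ∙ (g ^ℕ n ∙ g) ⁻¹           ≈⟨ ∙-congˡ (⁻¹-cong (^ℕ-comm g n)) ⟨
    g ^ℕ ℕ.suc m ∙ (g ^ℕ ℕ.suc n) ⁻¹         ∎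

  ^ℤ-homo-neg : ∀ g i → g ^ℤ (ℤ.- i) ≈ (g ^ℤ i) ⁻¹
  ^ℤ-homo-neg g (+ zero)    = sym ε⁻¹≈ε
  ^ℤ-homo-neg g (+ ℕ.suc n) = refl
  ^ℤ-homo-neg g -[1+ n ]    = sym (⁻¹-involutive _)

  private
    ^ℤ-homo-+neg : ∀ g m n → g ^ℤ (m ⊖ n) ≈ (g ^ℕ n) ⁻¹ ∙ g ^ℕ m
    ^ℤ-homo-+neg g m n = begin
      g ^ℤ (m ⊖ n)             ≡⟨ ≡.cong (g ^ℤ_) (ℤₚ.⊖-swap m n) ⟩
      g ^ℤ (ℤ.- (n ⊖ m))       ≈⟨ ^ℤ-homo-neg g (n ⊖ m) ⟩
      (g ^ℤ (n ⊖ m)) ⁻¹        ≈⟨ ⁻¹-cong (^ℤ-homo-⊖ g n m) ⟩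
      (g ^ℕ n ∙ (g ^ℕ m) ⁻¹) ⁻¹ ≈⟨ ⁻¹-anti-homo-// (g ^ℕ n) (g ^ℕ m) ⟩
      g ^ℕ m ∙ (g ^ℕ n) ⁻¹    ≈⟨ comm-inv ⟩
      (g ^ℕ n) ⁻¹ ∙ g ^ℕ m    ∎
      where
      comm-powers : g ^ℕ n ∙ g ^ℕ m ≈ g ^ℕ m ∙ g ^ℕ n
      comm-powers = begin
        g ^ℕ n ∙ g ^ℕ m  ≈⟨ ^ℕ-homo g n m ⟨
        g ^ℕ (n ℕ.+ m)   ≡⟨ ≡.cong (g ^ℕ_) (ℕₚ.+-comm n m) ⟩
        g ^ℕ (m ℕ.+ n)   ≈⟨ ^ℕ-homo g m n ⟩
        g ^ℕ m ∙ g ^ℕ n  ∎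
      comm-inv : g ^ℕ m ∙ (g ^ℕ n) ⁻¹ ≈ (g ^ℕ n) ⁻¹ ∙ g ^ℕ m
      comm-inv = begin
        g ^ℕ m ∙ (g ^ℕ n) ⁻¹                            ≈⟨ ∙-congʳ (\\-leftDividesʳ (g ^ℕ n) (g ^ℕ m)) ⟨
        (g ^ℕ n) ⁻¹ ∙ (g ^ℕ n ∙ g ^ℕ m) ∙ (g ^ℕ n) ⁻¹   ≈⟨ ∙-congʳ (∙-congˡ comm-powers) ⟩
        (g ^ℕ n) ⁻¹ ∙ (g ^ℕ m ∙ g ^ℕ n) ∙ (g ^ℕ n) ⁻¹   ≈⟨ assoc _ _ _ ⟩
        (g ^ℕ n) ⁻¹ ∙ ((g ^ℕ m ∙ g ^ℕ n) ∙ (g ^ℕ n) ⁻¹) ≈⟨ ∙-congˡ (//-rightDividesʳ (g ^ℕ n) (g ^ℕ m)) ⟩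
        (g ^ℕ n) ⁻¹ ∙ g ^ℕ m                            ∎

  ^ℤ-homo-+ : ∀ g i j → g ^ℤ (i ℤ.+ j) ≈ g ^ℤ i ∙ g ^ℤ j
  ^ℤ-homo-+ g (+ m)    (+ n)    = ^ℕ-homo g m n
  ^ℤ-homo-+ g (+ m)    -[1+ n ] = ^ℤ-homo-⊖ g m (ℕ.suc n)
  ^ℤ-homo-+ g -[1+ m ] (+ n)    = ^ℤ-homo-+neg g n (ℕ.suc m)
  ^ℤ-homo-+ g -[1+ m ] -[1+ n ] = begin
    (g ^ℕ (ℕ.suc (ℕ.suc (m ℕ.+ n)))) ⁻¹       ≡⟨ ≡.cong (λ k → (g ^ℕ k) ⁻¹) eq ⟩
    (g ^ℕ (ℕ.suc n ℕ.+ ℕ.suc m)) ⁻¹           ≈⟨ ⁻¹-cong (^ℕ-homo g (ℕ.suc n) (ℕ.suc m)) ⟩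
    (g ^ℕ ℕ.suc n ∙ g ^ℕ ℕ.suc m) ⁻¹          ≈⟨ ⁻¹-anti-homo-∙ _ _ ⟩
    (g ^ℕ ℕ.suc m) ⁻¹ ∙ (g ^ℕ ℕ.suc n) ⁻¹     ∎
    where
    eq : ℕ.suc (ℕ.suc (m ℕ.+ n)) ≡ ℕ.suc n ℕ.+ ℕ.suc m
    eq = ≡.cong ℕ.suc (ℕₚ.+-comm (ℕ.suc m) n)

  ⟨_⟩ : Carrier → Subgroup G ℓ
  ⟨ c ⟩ = record
    { Member    = λ g → ∃[ i ] g ≈ c ^ℤ i
    ; resp      = λ g≈h (i , g≈cⁱ) → i , trans (sym g≈h) g≈cⁱ
    ; ε-closed  = + 0 , refl
    ; ∙-closed  = λ (i , g≈cⁱ) (j , h≈cʲ) → i ℤ.+ j ,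
                    trans (∙-cong g≈cⁱ h≈cʲ) (sym (^ℤ-homo-+ c i j))
    ; ⁻¹-closed = λ (i , g≈cⁱ) → ℤ.- i ,
                    trans (⁻¹-cong g≈cⁱ) (sym (^ℤ-homo-neg c i))
    }

-- The cyclic group ℤ/nℤ: integers, compared modulo n.
CyclicGroup : ℕ → AbelianGroup 0ℓ 0ℓ
CyclicGroup n = record
  { Carrier = ℤ
  ; _≈_     = λ i j → + n ∣ i ℤ.- j
  ; _∙_     = ℤ._+_
  ; ε       = + 0
  ; _⁻¹     = ℤ.-_
  ; isAbelianGroup = record
    { isGroup = record
      { isMonoid = record
        { isSemigroup = record
          { isMagma = record
            { isEquivalence = record
              { refl  = λ {i} → reflexive (≡.refl {x = i})
              ; sym   = λ {i} {j} d → ≡.subst (+ n ∣_) (negate i j) (∣m⇒∣-m d)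
              ; trans = λ {i} {j} {k} d d′ →
                  ≡.subst (+ n ∣_) (telescope i j k) (∣m∣n⇒∣m+n d d′)
              }
            ; ∙-cong = λ {i} {i′} {j} {j′} d d′ →
                ≡.subst (+ n ∣_) (interchange i i′ j j′) (∣m∣n⇒∣m+n d d′)
            }
          ; assoc = λ i j k → reflexive (ℤₚ.+-assoc i j k)
          }
        ; identity = (λ i → reflexive (ℤₚ.+-identityˡ i))
                   , (λ i → reflexive (ℤₚ.+-identityʳ i))
        }
      ; inverse = (λ i → reflexive (ℤₚ.+-inverseˡ i))
                , (λ i → reflexive (ℤₚ.+-inverseʳ i))
      ; ⁻¹-cong = λ {i} {j} d → ≡.subst (+ n ∣_) (distribute i j) (∣m⇒∣-m d)
      }
    ; comm = λ i j → reflexive (ℤₚ.+-comm i j)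
    }
  }
  where
  reflexive : ∀ {i j} → i ≡ j → + n ∣ i ℤ.- j
  reflexive {i} ≡.refl = divides (+ 0) (ℤₚ.+-inverseʳ i)
  negate : ∀ i j → ℤ.- (i ℤ.- j) ≡ j ℤ.- i
  negate = solve-∀
  telescope : ∀ i j k → (i ℤ.- j) ℤ.+ (j ℤ.- k) ≡ i ℤ.- k
  telescope = solve-∀
  interchange : ∀ i i′ j j′ → (i ℤ.- i′) ℤ.+ (j ℤ.- j′) ≡ (i ℤ.+ j) ℤ.- (i′ ℤ.+ j′)
  interchange = solve-∀
  distribute : ∀ i j → ℤ.- (i ℤ.- j) ≡ (ℤ.- i) ℤ.- (ℤ.- j)
  distribute = solve-∀

module _ (G : AbelianGroup a ℓ) where
  private module G = AbelianGroup G
  open G using (_≈_; _∙_; ε; _⁻¹)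
  open AbelianGroupProperties G using (ε⁻¹≈ε; ⁻¹-involutive; ⁻¹-∙-comm)

  -- Action of the group of order 2 (written as parities) by inversion.
  act : Parity → G.Carrier → G.Carrier
  act 0ℙ g = g
  act 1ℙ g = g ⁻¹

  private
    act-cong : ∀ r {g h} → g ≈ h → act r g ≈ act r h
    act-cong 0ℙ g≈h = g≈h
    act-cong 1ℙ g≈h = G.⁻¹-cong g≈h

    act-ε : ∀ r → act r ε ≈ ε
    act-ε 0ℙ = G.refl
    act-ε 1ℙ = ε⁻¹≈ε

    act-∙ : ∀ r g h → act r (g ∙ h) ≈ act r g ∙ act r h
    act-∙ 0ℙ g h = G.refl
    act-∙ 1ℙ g h = G.sym (⁻¹-∙-comm g h)

    act-act : ∀ q r g → act r (act q g) ≈ act (q ℙ.+ r) g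
    act-act 0ℙ r  g = G.refl
    act-act 1ℙ 0ℙ g = G.refl
    act-act 1ℙ 1ℙ g = ⁻¹-involutive g

    act-⁻¹ : ∀ r g → act r (g ⁻¹) ∙ act r g ≈ ε
    act-⁻¹ r g = G.trans (G.sym (act-∙ r (g ⁻¹) g))
                         (G.trans (act-cong r (G.inverseˡ g)) (act-ε r))

  -- The pair (p , g) stands for xᵖg.  As gx = xg⁻¹, we have
  -- g xᵖ = xᵖ (act p g), which gives the product and the inverse.
  Dih : Group a ℓ
  Dih = record
    { Carrier = Parity × G.Carrier
    ; _≈_     = Setoid._≈_ carrier
    ; _∙_     = λ (p , g) (q , h) → p ℙ.+ q , act q g ∙ h
    ; ε       = 0ℙ , ε
    ; _⁻¹     = λ (p , g) → p , act p (g ⁻¹)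
    ; isGroup = record
      { isMonoid = record
        { isSemigroup = record
          { isMagma = record
            { isEquivalence = Setoid.isEquivalence carrier
            ; ∙-cong = λ { {_} {_} {q , _} (≡.refl , g≈g′) (≡.refl , h≈h′) →
                ≡.refl , G.∙-cong (act-cong q g≈g′) h≈h′ }
            }
          ; assoc = λ (p , g) (q , h) (r , k) →
              ℙₚ.+-assoc p q r ,
              G.trans (G.∙-congʳ (G.trans (act-∙ r (act q g) h)
                                          (G.∙-congʳ (act-act q r g))))
                      (G.assoc _ _ _)
          }
        ; identity = (λ (p , g) → ≡.refl ,
                       G.trans (G.∙-congʳ (act-ε p)) (G.identityˡ g))
                   , (λ (p , g) → ℙₚ.+-identityʳ p , G.identityʳ g)
        }
      ; inverse = (λ (p , g) → ℙₚ.p+p≡0ℙ p , inverseˡ p g)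
                , (λ (p , g) → ℙₚ.p+p≡0ℙ p , inverseʳ p g)
      ; ⁻¹-cong = λ { {p , _} (≡.refl , g≈h) → ≡.refl , act-cong p (G.⁻¹-cong g≈h) }
      }
    }
    where
    carrier : Setoid a ℓ
    carrier = ×-setoid (≡ₚ.setoid Parity) G.setoid
    inverseˡ : ∀ p g → act p (act p (g ⁻¹)) ∙ g ≈ ε
    inverseˡ 0ℙ g = G.inverseˡ g
    inverseˡ 1ℙ g = G.trans (G.∙-congʳ (⁻¹-involutive (g ⁻¹))) (G.inverseˡ g)
    inverseʳ : ∀ p g → act p g ∙ act p (g ⁻¹) ≈ ε
    inverseʳ p g = G.trans (G.comm _ _) (act-⁻¹ p g)

  private module D = Group Dih

  ι : G.Carrier → D.Carrier
  ι g = 0ℙ , g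

  x : D.Carrier
  x = 1ℙ , ε

  xG : Pred D.Carrier (a ⊔ ℓ)
  xG d = ∃[ g ] d D.≈ x D.∙ ι g

  ι-homo : ∀ g h → ι (g ∙ h) D.≈ ι g D.∙ ι h
  ι-homo g h = D.refl

  x²≈ε : x D.∙ x D.≈ D.ε
  x²≈ε = ≡.refl , G.inverseˡ ε

  gx≈xg⁻¹ : ∀ g → ι g D.∙ x D.≈ x D.∙ ι (g ⁻¹)
  gx≈xg⁻¹ g = ≡.refl , G.comm (g ⁻¹) ε

{-# OPTIONS --safe #-}

-- Write y = xh and b = hc, and number the vertices of Γ as g and (xb)g, with
-- g ∈ G.  The map σ sending g to (xb)g and (xb)g to gc is an automorphism of Γ:
-- it inverts differences within each coset, and across the cosets this is the
-- hypothesis on y.  It commutes with the right translations by G, and σ² is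
-- translation by c.  So the translations together with σ form an abelian group
-- acting regularly on Γ, namely the extension of G by a square root σ of c.  As
-- c has order 2ᵏ and G = ⟨c⟩ × A, this group is ⟨σ⟩ × A with σ of order 2ᵏ⁺¹.
module Submission where

open import Defs
open import Algebra.Bundles using (Group; AbelianGroup)
open import Algebra.Construct.DirectProduct using () renaming (abelianGroup to _×ᴳ_)
import Algebra.Properties.CommutativeSemigroup as CommutativeSemigroupProperties
import Algebra.Properties.Group as GroupProperties
import Algebra.Properties.Monoid.Mult as MonoidMult
import Algebra.Solver.CommutativeMonoid as CommutativeMonoidSolver
open import Data.Integer.Base as ℤ using (ℤ; +_; -[1+_])
open import Data.Integer.DivMod using (_/ℕ_; _%ℕ_; n%ℕd<d; a≡a%ℕn+[a/ℕn]*n)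
open import Data.Integer.Divisibility.Signed using (_∣_; divides)
import Data.Integer.Properties as ℤₚ
open import Data.Nat.Base as ℕ using (ℕ; _^_; suc; zero)
import Data.Nat.Properties as ℕₚ
open import Data.Parity.Base as ℙ using (Parity; 0ℙ; 1ℙ)
import Data.Parity.Properties as ℙₚ
open import Data.Product.Base using (_×_; ∃-syntax; _,_; proj₁; proj₂)
open import Data.Product.Relation.Binary.Pointwise.NonDependent using (×-setoid)
open import Function.Bundles using (_⇔_; mk⇔; Equivalence; Inverse)
import Function.Construct.Composition as Composition
import Function.Construct.Symmetry as Symmetry
open import Level using (Level)
open import Relation.Binary.Bundles using (Setoid)
open import Relation.Binary.PropositionalEquality.Core as ≡ using (_≡_)
import Relation.Binary.PropositionalEquality.Properties as ≡ₚ
import Relation.Binary.Reasoning.Setoid as SetoidReasoning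
open import Relation.Nullary.Negation using (contradiction)
open import Relation.Unary using (_∈_; _∩_)

private
  variable
    a ℓ s p v e ℓ′ : Level

-- Graphs with a regular group of automorphisms are Cayley graphs.

module _ (Γ : Graph v ℓ e) (K : Group a ℓ′) where
  private
    module Γ = Graph Γ
  open Group K
  open GroupProperties K using (//-rightDividesˡ)

  -- Right translation by the inverse of u turns an edge from u to w into one from `ε` to `w // u`,
  -- so the neighbours of the vertex `to ε` determine the graph and serve as the connection set. The
  -- translations are on the right because `Cay` multiplies by that set on the left.
  regular⇒IsCayleyGraphOn :
    (f : Inverse setoid Γ.vertices) → let open Inverse f using (to) in
    (∀ t {u w} → Γ.Adj (to u) (to w) → Γ.Adj (to (u ∙ t)) (to (w ∙ t))) →
    IsCayleyGraphOn Γ K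
  regular⇒IsCayleyGraphOn f translate = T , record
    { bijection = Symmetry.inverse f
    ; to-adj    = λ u w → mk⇔ (adj⇒ u w) (adj⇐ u w)
    }
    where
    open Inverse f using (to; from; to-cong; strictlyInverseˡ)
    module V = Setoid Γ.vertices

    adj-resp : ∀ {u u′ w w′} → u V.≈ u′ → w V.≈ w′ → Γ.Adj u w → Γ.Adj u′ w′
    adj-resp u≈u′ w≈w′ uw = proj₂ Γ.Adj-resp u≈u′ (proj₁ Γ.Adj-resp w≈w′ uw)

    T : InverseClosedSubset K _
    T = record
      { Member    = λ t → Γ.Adj (to ε) (to t)
      ; resp      = λ t≈t′ → adj-resp V.refl (to-cong t≈t′)
      -- Translating the edge from `ε` to `t` by `t ⁻¹` gives an edge from `t ⁻¹` to `ε`.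
      ; ⁻¹-closed = λ {t} εt → Γ.Adj-sym
          (adj-resp (to-cong (identityˡ _)) (to-cong (inverseʳ t)) (translate (t ⁻¹) εt))
      }

    adj⇒ : ∀ u w → Γ.Adj u w → Graph.Adj (Cay K T) (from u) (from w)
    adj⇒ u w uw = from w // from u ,
      adj-resp (to-cong (inverseʳ (from u))) V.refl
        (translate (from u ⁻¹)
          (adj-resp (V.sym (strictlyInverseˡ u)) (V.sym (strictlyInverseˡ w)) uw)) ,
      sym (//-rightDividesˡ (from u) (from w))

    adj⇐ : ∀ u w → Graph.Adj (Cay K T) (from u) (from w) → Γ.Adj u w
    adj⇐ u w (t , εt , w≈tu) =
      adj-resp (V.trans (to-cong (identityˡ _)) (strictlyInverseˡ u))
               (V.trans (to-cong (sym w≈tu)) (strictlyInverseˡ w))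
               (translate (from u) εt)

  -- Transport along an isomorphism: `φ` carries the translations of `K` to those of `E`, so the
  -- action may be checked on whichever group has the more convenient coordinates.
  regular-≅⇒IsCayleyGraphOn :
    ∀ {b ℓᴱ} (E : Group b ℓᴱ) → let module E = Group E in
    (φ : Inverse setoid E.setoid) → let module φ = Inverse φ in
    (∀ u w → φ.to (u ∙ w) E.≈ φ.to u E.∙ φ.to w) →
    (f : Inverse E.setoid Γ.vertices) → let module f = Inverse f in
    (∀ t {u w} → Γ.Adj (f.to u) (f.to w) → Γ.Adj (f.to (u E.∙ t)) (f.to (w E.∙ t))) →
    IsCayleyGraphOn Γ K
  regular-≅⇒IsCayleyGraphOn E φ homo f translate =
    regular⇒IsCayleyGraphOn (Composition.inverse φ f) λ t {u} {w} uw →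
      proj₂ Γ.Adj-resp (f.to-cong (E.sym (homo u t)))
        (proj₁ Γ.Adj-resp (f.to-cong (E.sym (homo w t))) (translate (φ.to t) uw))
    where
    module E = Group E
    module φ = Inverse φ
    module f = Inverse f

-- Integer powers and orders of elements.

module _ (K : Group a ℓ) where
  open Group K
  open GroupProperties K using (identityˡ-unique; inverseˡ-unique)
  open MonoidMult monoid using (×-congʳ)
  open SetoidReasoning setoid
  private
    infixr 8 _^^_
    _^^_ : Carrier → ℤ → Carrier
    _^^_ = _^ℤ_ K

  ^ℤ-cong : ∀ {g h} → g ≈ h → ∀ i → g ^^ i ≈ h ^^ i
  ^ℤ-cong g≈h (+ n)    = ×-congʳ n g≈h
  ^ℤ-cong g≈h -[1+ n ] = ⁻¹-cong (×-congʳ (suc n) g≈h)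

  -- The group ℤ is free on 1. Applied to suitable `f`, this yields power laws without a case split
  -- on signs.
  ^ℤ-unique : (f : ℤ → Carrier) → (∀ i j → f (i ℤ.+ j) ≈ f i ∙ f j) →
              ∀ i → f i ≈ f (+ 1) ^^ i
  ^ℤ-unique f homo = go
    where
    f0≈ε : f (+ 0) ≈ ε
    f0≈ε = identityˡ-unique _ _ (sym (homo (+ 0) (+ 0)))

    goℕ : ∀ n → f (+ n) ≈ f (+ 1) ^^ (+ n)
    goℕ zero    = f0≈ε
    goℕ (suc n) = trans (homo (+ 1) (+ n)) (∙-congˡ (goℕ n))

    go : ∀ i → f i ≈ f (+ 1) ^^ i
    go (+ n)    = goℕ n
    go -[1+ n ] = trans
      (inverseˡ-unique _ _ (begin
        f -[1+ n ] ∙ f (+ suc n)      ≈⟨ homo -[1+ n ] (+ suc n) ⟨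
        f (-[1+ n ] ℤ.+ + suc n)      ≡⟨ ≡.cong f (ℤₚ.+-inverseˡ (+ suc n)) ⟩
        f (+ 0)                       ≈⟨ f0≈ε ⟩
        ε                             ∎))
      (⁻¹-cong (goℕ (suc n)))

  ε^ℤ≈ε : ∀ i → ε ^^ i ≈ ε
  ε^ℤ≈ε i = sym (^ℤ-unique (λ _ → ε) (λ _ _ → sym (identityˡ ε)) i)

  -- For fixed j the map sending i to the left side is a homomorphism from ℤ with value `g ^^ j` at
  -- 1.
  ^ℤ-* : ∀ g i j → g ^^ (i ℤ.* j) ≈ (g ^^ j) ^^ i
  ^ℤ-* g i j = begin
    g ^^ (i ℤ.* j)          ≈⟨ ^ℤ-unique (λ i′ → g ^^ (i′ ℤ.* j)) homo i ⟩
    (g ^^ (+ 1 ℤ.* j)) ^^ i ≡⟨ ≡.cong (λ j′ → (g ^^ j′) ^^ i) (ℤₚ.*-identityˡ j) ⟩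
    (g ^^ j) ^^ i           ∎
    where
    homo : ∀ m n → g ^^ ((m ℤ.+ n) ℤ.* j) ≈ g ^^ (m ℤ.* j) ∙ g ^^ (n ℤ.* j)
    homo m n = trans (reflexive (≡.cong (g ^^_) (ℤₚ.*-distribʳ-+ j m n)))
                     (^ℤ-homo-+ K g (m ℤ.* j) (n ℤ.* j))

  ^ℤ-multiple : ∀ {g n} → HasOrder K g n → ∀ q → g ^^ (q ℤ.* + n) ≈ ε
  ^ℤ-multiple {g} {n} order q =
    trans (^ℤ-* g q (+ n)) (trans (^ℤ-cong (HasOrder.power order) q) (ε^ℤ≈ε q))

  -- Division with remainder: the remainder also annihilates `g` and is smaller than `n`, so
  -- minimality of the order forces it to be 0.
  order∣ : ∀ {g n} → HasOrder K g n → ∀ i → g ^^ i ≈ ε → + n ∣ i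
  -- The remainder is passed as a variable with an equation, so that it can be matched while
  -- `division` keeps its form.
  order∣ {g} {n} order i gⁱ≈ε = remainder-zero (i %ℕ n) ≡.refl
    where
    open HasOrder order
    instance
      n≢0 : ℕ.NonZero n
      n≢0 = ℕ.>-nonZero positive

    division : i ≡ + (i %ℕ n) ℤ.+ (i /ℕ n) ℤ.* + n
    division = a≡a%ℕn+[a/ℕn]*n i n

    remainder-power : g ^^ (+ (i %ℕ n)) ≈ ε
    remainder-power = begin
      g ^^ r                            ≈⟨ identityʳ _ ⟨
      g ^^ r ∙ ε                        ≈⟨ ∙-congˡ (^ℤ-multiple order (i /ℕ n)) ⟨
      g ^^ r ∙ g ^^ ((i /ℕ n) ℤ.* + n)  ≈⟨ ^ℤ-homo-+ K g r ((i /ℕ n) ℤ.* + n) ⟨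
      g ^^ (r ℤ.+ (i /ℕ n) ℤ.* + n)     ≡⟨ ≡.cong (g ^^_) division ⟨
      g ^^ i                            ≈⟨ gⁱ≈ε ⟩
      ε                                 ∎
      where r = + (i %ℕ n)

    remainder-zero : ∀ r → i %ℕ n ≡ r → + n ∣ i
    remainder-zero zero    eq = divides (i /ℕ n)
      (≡.trans division
        (≡.trans (≡.cong (λ r → + r ℤ.+ (i /ℕ n) ℤ.* + n) eq) (ℤₚ.+-identityˡ _)))
    remainder-zero (suc r) eq = contradiction
      (minimal (i %ℕ n) (≡.subst (0 ℕ.<_) (≡.sym eq) ℕ.z<s) remainder-power)
      (ℕₚ.<⇒≱ (n%ℕd<d i n))

-- The abelian extension of G by a square root of c.

-- The pair (p , g) stands for σᵖg, where σ² = c; below, √ is σ.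
module SquareRootExtension (G : AbelianGroup a ℓ) (c : AbelianGroup.Carrier G) where
  private module G = AbelianGroup G
  open G using (_≈_; _∙_; ε; _⁻¹)
  open CommutativeMonoidSolver G.commutativeMonoid using (solve; _⊕_; _⊜_; id)

  -- The factor set of the extension, a carry in binary addition: σᵖ times σ^q is σ^(p+q), with p+q
  -- taken modulo 2, times `carry p q`.
  carry : Parity → Parity → G.Carrier
  carry 0ℙ _  = ε
  carry 1ℙ 0ℙ = ε
  carry 1ℙ 1ℙ = c

  private
    carry-comm : ∀ p q → carry p q ≈ carry q p
    carry-comm 0ℙ 0ℙ = G.refl
    carry-comm 0ℙ 1ℙ = G.refl
    carry-comm 1ℙ 0ℙ = G.refl
    carry-comm 1ℙ 1ℙ = G.refl

    carry-0ʳ : ∀ p → carry p 0ℙ ≈ ε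
    carry-0ʳ p = carry-comm p 0ℙ

    -- The 2-cocycle identity behind associativity. Both sides are a power of c whose exponent is
    -- the integer part of (p+q+r)/2.
    carry-cocycle : ∀ p q r →
      carry p q ∙ carry (p ℙ.+ q) r ≈ carry q r ∙ carry p (q ℙ.+ r)
    carry-cocycle 0ℙ q  r  = G.comm _ _
    carry-cocycle 1ℙ 0ℙ r  = G.refl
    carry-cocycle 1ℙ 1ℙ 0ℙ = G.comm _ _
    carry-cocycle 1ℙ 1ℙ 1ℙ = G.refl

    carrier : Setoid _ _
    carrier = ×-setoid (≡ₚ.setoid Parity) G.setoid

    infixl 7 _·_
    _·_ : Parity × G.Carrier → Parity × G.Carrier → Parity × G.Carrier
    (p , g) · (q , h) = p ℙ.+ q , g ∙ h ∙ carry p q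

    assoc : ∀ u v w → Setoid._≈_ carrier (u · v · w) (u · (v · w))
    assoc (p , g) (q , h) (r , k) = ℙₚ.+-assoc p q r , (begin
      (g ∙ h ∙ carry p q) ∙ k ∙ carry (p ℙ.+ q) r
        ≈⟨ solve 5 (λ g h k m n → ((((g ⊕ h) ⊕ m) ⊕ k) ⊕ n) ⊜ (((g ⊕ h) ⊕ k) ⊕ (m ⊕ n)))
                 G.refl g h k (carry p q) (carry (p ℙ.+ q) r) ⟩
      (g ∙ h ∙ k) ∙ (carry p q ∙ carry (p ℙ.+ q) r)
        ≈⟨ G.∙-congˡ (carry-cocycle p q r) ⟩
      (g ∙ h ∙ k) ∙ (carry q r ∙ carry p (q ℙ.+ r))
        ≈⟨ solve 5 (λ g h k m n → (((g ⊕ h) ⊕ k) ⊕ (m ⊕ n)) ⊜ ((g ⊕ ((h ⊕ k) ⊕ m)) ⊕ n))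
                 G.refl g h k (carry q r) (carry p (q ℙ.+ r)) ⟩
      g ∙ (h ∙ k ∙ carry q r) ∙ carry p (q ℙ.+ r) ∎)
      where open SetoidReasoning G.setoid

    comm : ∀ u v → Setoid._≈_ carrier (u · v) (v · u)
    comm (p , g) (q , h) = ℙₚ.+-comm p q , G.∙-cong (G.comm g h) (carry-comm p q)

    identityˡ : ∀ u → Setoid._≈_ carrier ((0ℙ , ε) · u) u
    identityˡ (p , g) = ≡.refl , G.trans (G.identityʳ _) (G.identityˡ g)

    -- The parity p is its own negative, and σᵖ squared is `carry p p`, which has to be divided out.
    inverse : Parity × G.Carrier → Parity × G.Carrier
    inverse (p , g) = p , (g ∙ carry p p) ⁻¹

    inverseʳ : ∀ u → Setoid._≈_ carrier (u · inverse u) (0ℙ , ε)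
    inverseʳ (p , g) = ℙₚ.p+p≡0ℙ p ,
      G.trans (solve 3 (λ g h m → ((g ⊕ h) ⊕ m) ⊜ ((g ⊕ m) ⊕ h)) G.refl g _ (carry p p))
              (G.inverseʳ (g ∙ carry p p))

  extension : AbelianGroup a ℓ
  extension = record
    { Carrier = Parity × G.Carrier
    ; _≈_     = Setoid._≈_ carrier
    ; _∙_     = _·_
    ; ε       = 0ℙ , ε
    ; _⁻¹     = inverse
    ; isAbelianGroup = record
      { isGroup = record
        { isMonoid = record
          { isSemigroup = record
            { isMagma = record
              { isEquivalence = Setoid.isEquivalence carrier
              ; ∙-cong = λ { (≡.refl , g≈g′) (≡.refl , h≈h′) →
                  ≡.refl , G.∙-congʳ (G.∙-cong g≈g′ h≈h′) }
              }
            ; assoc = assoc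
            }
          ; identity = identityˡ
                     , λ u → Setoid.trans carrier (comm u (0ℙ , ε)) (identityˡ u)
          }
        ; inverse = (λ u → Setoid.trans carrier (comm (inverse u) u) (inverseʳ u))
                  , inverseʳ
        ; ⁻¹-cong = λ { (≡.refl , g≈h) → ≡.refl , G.⁻¹-cong (G.∙-congʳ g≈h) }
        }
      ; comm = comm
      }
    }

  private module E = AbelianGroup extension

  embed : G.Carrier → E.Carrier
  embed g = 0ℙ , g

  embed-homo : ∀ g h → embed (g ∙ h) E.≈ embed g E.∙ embed h
  embed-homo g h = ≡.refl , G.sym (G.identityʳ _)

  √ : E.Carrier
  √ = 1ℙ , ε

  √∙embed : ∀ g → √ E.∙ embed g E.≈ (1ℙ , g)
  √∙embed g = ≡.refl , G.trans (G.identityʳ _) (G.identityˡ g)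

  ∙embed : ∀ p g h → (p , g) E.∙ embed h E.≈ (p , g ∙ h)
  ∙embed p g h = ℙₚ.+-identityʳ p , G.trans (G.∙-congˡ (carry-0ʳ p)) (G.identityʳ _)

  √-even-power : ∀ j → _^ℤ_ E.group √ (j ℤ.* + 2) E.≈ embed (_^ℤ_ G.group c j)
  √-even-power j = begin
    √ ^ᴱ (j ℤ.* + 2)             ≈⟨ ^ℤ-* E.group √ j (+ 2) ⟩
    (√ ^ᴱ + 2) ^ᴱ j              ≈⟨ ^ℤ-cong E.group √²≈c j ⟩
    embed (c ^ᴳ + 1) ^ᴱ j        ≈⟨ ^ℤ-unique E.group (λ i → embed (c ^ᴳ i)) homo j ⟨
    embed (c ^ᴳ j)               ∎
    where
    open SetoidReasoning E.setoid
    infixr 8 _^ᴱ_ _^ᴳ_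
    _^ᴱ_ = _^ℤ_ E.group
    _^ᴳ_ = _^ℤ_ G.group

    -- `c ^ᴳ + 1` stands for c because this is the value at 1 that `^ℤ-unique` produces.
    √²≈c : √ ^ᴱ + 2 E.≈ embed (c ^ᴳ + 1)
    √²≈c = ≡.refl ,
      solve 1 (λ c → ((id ⊕ ((id ⊕ id) ⊕ id)) ⊕ c) ⊜ (c ⊕ id)) G.refl c

    homo : ∀ i j → embed (c ^ᴳ (i ℤ.+ j)) E.≈ embed (c ^ᴳ i) E.∙ embed (c ^ᴳ j)
    homo i j = E.trans (≡.refl , ^ℤ-homo-+ G.group c i j) (embed-homo _ _)

  √-odd-power : ∀ j → _^ℤ_ E.group √ (+ 1 ℤ.+ j ℤ.* + 2) E.≈ (1ℙ , _^ℤ_ G.group c j)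
  √-odd-power j = begin
    _^ℤ_ E.group √ (+ 1 ℤ.+ j ℤ.* + 2)       ≈⟨ ^ℤ-homo-+ E.group √ (+ 1) (j ℤ.* + 2) ⟩
    √ E.∙ E.ε E.∙ _^ℤ_ E.group √ (j ℤ.* + 2) ≈⟨ E.∙-cong (E.identityʳ √) (√-even-power j) ⟩
    √ E.∙ embed (_^ℤ_ G.group c j)           ≈⟨ √∙embed _ ⟩
    (1ℙ , _^ℤ_ G.group c j)                  ∎
    where open SetoidReasoning E.setoid

-- Decomposition of the extension as a cyclic group of order 2ᵏ⁺¹ times A.

module _ (G : AbelianGroup a ℓ) (k : ℕ) (c : AbelianGroup.Carrier G)
         (A : Subgroup (AbelianGroup.group G) p)
         (order : HasOrder (AbelianGroup.group G) c (2 ^ k))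
         (direct : IsInternalDirectProduct G (⟨_⟩ (AbelianGroup.group G) c) A) where
  private
    module G = AbelianGroup G
    module A = Subgroup A
  open SquareRootExtension G c
  private
    module E = AbelianGroup extension
    module K = AbelianGroup (CyclicGroup (2 ^ suc k) ×ᴳ subgroupAbelianGroup G A)
  open GroupProperties E.group using (identityˡ-unique)
  open GroupProperties K.group using (x∙y⁻¹≈ε⇒x≈y; //-rightDividesˡ)
  open CommutativeSemigroupProperties E.commutativeSemigroup using (interchange)
  open SetoidReasoning E.setoid
  private
    infixr 8 _^ᴱ_ _^ᴳ_
    _^ᴱ_ = _^ℤ_ E.group
    _^ᴳ_ = _^ℤ_ G.group

    double-multiple : ∀ q → q ℤ.* + (2 ^ suc k) ≡ (q ℤ.* + (2 ^ k)) ℤ.* + 2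
    double-multiple q = ≡.trans
      (≡.cong (q ℤ.*_) (≡.trans (≡.cong +_ (ℕₚ.*-comm 2 (2 ^ k))) (ℤₚ.pos-* (2 ^ k) 2)))
      (≡.sym (ℤₚ.*-assoc q _ (+ 2)))

    -- As σ² = c and c has order 2ᵏ, the power of σ with exponent 2ᵏ⁺¹ is trivial. This makes `φ`
    -- well defined on residues.
    √-power-ε : ∀ i → + (2 ^ suc k) ∣ i → √ ^ᴱ i E.≈ E.ε
    √-power-ε _ (divides q ≡.refl) = begin
      √ ^ᴱ (q ℤ.* + (2 ^ suc k))       ≡⟨ ≡.cong (√ ^ᴱ_) (double-multiple q) ⟩
      √ ^ᴱ ((q ℤ.* + (2 ^ k)) ℤ.* + 2) ≈⟨ √-even-power (q ℤ.* + (2 ^ k)) ⟩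
      embed (c ^ᴳ (q ℤ.* + (2 ^ k)))   ≈⟨ ≡.refl , ^ℤ-multiple G.group order q ⟩
      E.ε                              ∎

    φ : K.Carrier → E.Carrier
    φ (i , g , _) = √ ^ᴱ i E.∙ embed g

    φ-homo : ∀ u w → φ (u K.∙ w) E.≈ φ u E.∙ φ w
    φ-homo (i , g , _) (j , h , _) = begin
      √ ^ᴱ (i ℤ.+ j) E.∙ embed (g G.∙ h)
        ≈⟨ E.∙-cong (^ℤ-homo-+ E.group √ i j) (embed-homo g h) ⟩
      (√ ^ᴱ i E.∙ √ ^ᴱ j) E.∙ (embed g E.∙ embed h)
        ≈⟨ interchange (√ ^ᴱ i) (√ ^ᴱ j) (embed g) (embed h) ⟩
      (√ ^ᴱ i E.∙ embed g) E.∙ (√ ^ᴱ j E.∙ embed h) ∎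

    -- `φ` in the coordinates of the extension: even exponents land in G, odd ones in the coset σG.
    φ-even : ∀ j g g∈A → φ (j ℤ.* + 2 , g , g∈A) E.≈ (0ℙ , c ^ᴳ j G.∙ g)
    φ-even j g _ = E.trans (E.∙-congʳ (√-even-power j)) (∙embed 0ℙ _ g)

    φ-odd : ∀ j g g∈A → φ (+ 1 ℤ.+ j ℤ.* + 2 , g , g∈A) E.≈ (1ℙ , c ^ᴳ j G.∙ g)
    φ-odd j g _ = E.trans (E.∙-congʳ (√-odd-power j)) (∙embed 1ℙ _ g)

    φ-cong : ∀ {u w} → u K.≈ w → φ u E.≈ φ w
    φ-cong {i , _} {j , _} (N∣i-j , g≈h) = E.∙-cong
      (begin
        √ ^ᴱ i                        ≡⟨ ≡.cong (√ ^ᴱ_) (ℤᴳ.//-rightDividesˡ j i) ⟨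
        √ ^ᴱ (i ℤ.- j ℤ.+ j)          ≈⟨ ^ℤ-homo-+ E.group √ (i ℤ.- j) j ⟩
        √ ^ᴱ (i ℤ.- j) E.∙ √ ^ᴱ j     ≈⟨ E.∙-congʳ (√-power-ε (i ℤ.- j) N∣i-j) ⟩
        E.ε E.∙ √ ^ᴱ j                ≈⟨ E.identityˡ _ ⟩
        √ ^ᴱ j                        ∎)
      (≡.refl , g≈h)
      where module ℤᴳ = GroupProperties (AbelianGroup.group ℤₚ.+-0-abelianGroup)

    -- An indexed family, so that matching puts the exponent into the exact shape used by `φ-even`
    -- and `φ-odd`.
    data Halved : ℤ → Set where
      even : ∀ j → Halved (j ℤ.* + 2)
      odd  : ∀ j → Halved (+ 1 ℤ.+ j ℤ.* + 2)

    halve : ∀ i → Halved i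
    halve i with i %ℕ 2 | n%ℕd<d i 2 | a≡a%ℕn+[a/ℕn]*n i 2
    ... | 0 | _ | eq =
      ≡.subst Halved (≡.sym (≡.trans eq (ℤₚ.+-identityˡ _))) (even (i /ℕ 2))
    ... | 1 | _ | eq = ≡.subst Halved (≡.sym eq) (odd (i /ℕ 2))
    ... | suc (suc _) | ℕ.s<s (ℕ.s<s ()) | _

    -- An odd exponent gives an element outside G. For exponent 2j, the power of c with exponent j
    -- is inverse to `g`, so it lies in both ⟨c⟩ and A and is trivial. Then 2ᵏ divides j, and 2ᵏ⁺¹
    -- divides 2j.
    φ-kernel : ∀ u → φ u E.≈ E.ε → u K.≈ K.ε
    φ-kernel (i , g , g∈A) eq with halve i
    ... | odd j  with () ← E.trans (E.sym (φ-odd j g g∈A)) eq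
    ... | even j = ∣⇒∣-0 (j ℤ.* + 2) (N∣ (order∣ G.group order j cʲ≈ε)) , g≈ε
      where
      cʲg≈ε : c ^ᴳ j G.∙ g G.≈ G.ε
      cʲg≈ε = proj₂ (E.trans (E.sym (φ-even j g g∈A)) eq)

      cʲ≈ε : c ^ᴳ j G.≈ G.ε
      cʲ≈ε = IsInternalDirectProduct.disjoint direct (j , G.refl)
        (A.resp (G.sym (GroupProperties.inverseˡ-unique G.group _ _ cʲg≈ε)) (A.⁻¹-closed g∈A))

      g≈ε : g G.≈ G.ε
      g≈ε = G.trans (G.sym (G.identityˡ g)) (G.trans (G.∙-congʳ (G.sym cʲ≈ε)) cʲg≈ε)

      N∣ : ∀ {j} → + (2 ^ k) ∣ j → + (2 ^ suc k) ∣ j ℤ.* + 2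
      N∣ (divides q ≡.refl) = divides q (≡.sym (double-multiple q))

      -- Congruence to the identity of `CyclicGroup` unfolds to divisibility of `i ℤ.- + 0`.
      ∣⇒∣-0 : ∀ {n} i → n ∣ i → n ∣ i ℤ.- + 0
      ∣⇒∣-0 {n} i = ≡.subst (n ∣_) (≡.sym (ℤₚ.+-identityʳ i))

    -- Multiplying the image of `u K.∙ w K.⁻¹` by `φ w` gives `φ u`, which equals `φ w`; so that
    -- quotient lies in the trivial kernel.
    φ-injective : ∀ {u w} → φ u E.≈ φ w → u K.≈ w
    φ-injective {u} {w} φu≈φw = x∙y⁻¹≈ε⇒x≈y u w (φ-kernel (u K.∙ w K.⁻¹)
      (identityˡ-unique (φ (u K.∙ w K.⁻¹)) (φ w) (begin
        φ (u K.∙ w K.⁻¹) E.∙ φ w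
          ≈⟨ φ-homo (u K.∙ w K.⁻¹) w ⟨
        φ (u K.∙ w K.⁻¹ K.∙ w)
          ≈⟨ φ-cong {u K.∙ w K.⁻¹ K.∙ w} {u} (//-rightDividesˡ w u) ⟩
        φ u
          ≈⟨ φu≈φw ⟩
        φ w ∎)))

    -- Write g as a power of c, with exponent j, times an element of A; the exponent of σ is then 2j
    -- or 2j+1 according to the parity.
    preimage : ∀ d → ∃[ u ] φ u E.≈ d
    preimage (p , g) with IsInternalDirectProduct.generate direct g
    preimage (0ℙ , g) | _ , h , (j , eq) , h∈A , g≈ = (j ℤ.* + 2 , h , h∈A) ,
      E.trans (φ-even j h h∈A) (≡.refl , G.sym (G.trans g≈ (G.∙-congʳ eq)))
    preimage (1ℙ , g) | _ , h , (j , eq) , h∈A , g≈ = (+ 1 ℤ.+ j ℤ.* + 2 , h , h∈A) ,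
      E.trans (φ-odd j h h∈A) (≡.refl , G.sym (G.trans g≈ (G.∙-congʳ eq)))

  cyclic×subgroup↔extension : Inverse K.setoid E.setoid
  cyclic×subgroup↔extension = record
    { to        = φ
    ; from      = λ d → proj₁ (preimage d)
    ; to-cong   = λ {u} {w} → φ-cong {u} {w}
    -- The decomposition chosen by `generate` need not respect `≈`, so congruence comes from
    -- injectivity of `φ`.
    ; from-cong = λ {d} {d′} d≈d′ → φ-injective {proj₁ (preimage d)} {proj₁ (preimage d′)}
        (E.trans (proj₂ (preimage d)) (E.trans d≈d′ (E.sym (proj₂ (preimage d′)))))
    ; inverse   =
        (λ {d} {u} u≈ → E.trans (φ-cong {u} {proj₁ (preimage d)} u≈) (proj₂ (preimage d)))
      , (λ {u} {d} d≈ → φ-injective {proj₁ (preimage d)} {u} (E.trans (proj₂ (preimage d)) d≈))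
    }

  cyclic×subgroup-homo : ∀ u w → Inverse.to cyclic×subgroup↔extension (u K.∙ w) E.≈
    Inverse.to cyclic×subgroup↔extension u E.∙ Inverse.to cyclic×subgroup↔extension w
  cyclic×subgroup-homo = φ-homo

-- The regular action of the extension on Γ.

module _ (G : AbelianGroup a ℓ) (S : InverseClosedSubset (Dih G) s)
         (h c : AbelianGroup.Carrier G) where
  private
    module G = AbelianGroup G
    module D = Group (Dih G)
    module S = InverseClosedSubset S
    module Γ = Graph (Cay (Dih G) S)
  open G using (_≈_; _∙_; _⁻¹)
  open GroupProperties G.group using (\\-leftDividesˡ; \\-leftDividesʳ)
  open SquareRootExtension G c
  open CommutativeMonoidSolver G.commutativeMonoid using (solve; _⊕_; _⊜_; id)
  open SetoidReasoning G.setoid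
  private
    module E = AbelianGroup extension

    -- With the factor c, an edge between the cosets with connection element yr is sent by σ to one
    -- with element yr⁻¹c.
    b : G.Carrier
    b = h ∙ c

    place : Parity → G.Carrier → G.Carrier
    place 0ℙ g = g
    place 1ℙ g = b ∙ g

    unplace : Parity → G.Carrier → G.Carrier
    unplace 0ℙ g = g
    unplace 1ℙ g = b ⁻¹ ∙ g

    place-cong : ∀ r {g g′} → g ≈ g′ → place r g ≈ place r g′
    place-cong 0ℙ = λ eq → eq
    place-cong 1ℙ = G.∙-congˡ

    unplace-cong : ∀ r {g g′} → g ≈ g′ → unplace r g ≈ unplace r g′
    unplace-cong 0ℙ = λ eq → eq
    unplace-cong 1ℙ = G.∙-congˡ

    place-unplace : ∀ r g → place r (unplace r g) ≈ g
    place-unplace 0ℙ g = G.refl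
    place-unplace 1ℙ g = \\-leftDividesˡ b g

    unplace-place : ∀ r g → unplace r (place r g) ≈ g
    unplace-place 0ℙ g = G.refl
    unplace-place 1ℙ g = \\-leftDividesʳ b g

    place-∙ : ∀ r g k → place r (g ∙ k) ≈ place r g ∙ k
    place-∙ 0ℙ g k = G.refl
    place-∙ 1ℙ g k = G.sym (G.assoc b g k)

    -- The orbit map of the identity vertex: σ sends 1 to xb, and translation by g sends that to
    -- xbg.
    θ : E.Carrier → D.Carrier
    θ (r , g) = r , place r g

    θ-cong : ∀ {u w} → u E.≈ w → θ u D.≈ θ w
    θ-cong {r , _} (≡.refl , eq) = ≡.refl , place-cong r eq

    adj-resp : ∀ {u u′ w w′} → u D.≈ u′ → w D.≈ w′ → Γ.Adj u w → Γ.Adj u′ w′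
    adj-resp u≈u′ w≈w′ uw = proj₂ Γ.Adj-resp u≈u′ (proj₁ Γ.Adj-resp w≈w′ uw)

    θ-∙embed : ∀ u k → θ u D.∙ ι G k D.≈ θ (u E.∙ embed k)
    θ-∙embed (r , g) k = D.trans
      (ℙₚ.+-identityʳ r , G.sym (place-∙ r g k))
      (θ-cong {r , g ∙ k} (E.sym (∙embed r g k)))

    -- Under `θ` this is right multiplication by k in Dih(G), which commutes with left
    -- multiplication by elements of S.
    translate-embed : ∀ k {u w} → Γ.Adj (θ u) (θ w) →
                      Γ.Adj (θ (u E.∙ embed k)) (θ (w E.∙ embed k))
    translate-embed k {u} {w} (t , t∈S , w≈tu) =
      adj-resp (θ-∙embed u k) (θ-∙embed w k)
        (t , t∈S , D.trans (D.∙-congʳ {ι G k} w≈tu) (D.assoc t (θ u) (ι G k)))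

  extension↔dihedral : Inverse E.setoid D.setoid
  extension↔dihedral = record
    { to        = θ
    ; from      = λ (r , g) → r , unplace r g
    ; to-cong   = θ-cong
    ; from-cong = λ { {r , _} (≡.refl , eq) → ≡.refl , unplace-cong r eq }
    ; inverse   =
        (λ { {r , g} (≡.refl , eq) → ≡.refl , G.trans (place-cong r eq) (place-unplace r g) })
      , (λ { {r , g} (≡.refl , eq) → ≡.refl , G.trans (unplace-cong r eq) (unplace-place r g) })
    }

  module _ (reflect : ∀ g → (1ℙ , h ∙ g) ∈ S.Member → (1ℙ , h ∙ g ⁻¹ ∙ c) ∈ S.Member) where
    private
      √-image₀ : ∀ g → θ ((0ℙ , g) E.∙ √) D.≈ (1ℙ , b ∙ g)
      √-image₀ g = ≡.refl , G.∙-congˡ (solve 1 (λ g → ((g ⊕ id) ⊕ id) ⊜ g) G.refl g)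

      √-image₁ : ∀ g → θ ((1ℙ , g) E.∙ √) D.≈ (0ℙ , g ∙ c)
      √-image₁ g = ≡.refl , G.∙-congʳ (G.identityʳ g)

      -- If yr in S joins g to xbg′, then yr⁻¹c is in S and joins g′c to xbg; `Γ.Adj-sym` then
      -- reverses this edge.
      cross : ∀ g g′ → Γ.Adj (θ (0ℙ , g)) (θ (1ℙ , g′)) →
              Γ.Adj (1ℙ , b ∙ g) (0ℙ , g′ ∙ c)
      cross g g′ ((1ℙ , t) , t∈S , _ , bg′≈tg) = Γ.Adj-sym
        ( (1ℙ , h ∙ r ⁻¹ ∙ c)
        , reflect r (S.resp (≡.refl , G.sym (\\-leftDividesˡ h t)) t∈S)
        , ≡.refl
        , G.sym (begin
            (h ∙ r ⁻¹ ∙ c) ∙ (g′ ∙ c)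
              ≈⟨ solve 4 (λ h r⁻¹ c g′ → (((h ⊕ r⁻¹) ⊕ c) ⊕ (g′ ⊕ c)) ⊜ ((r⁻¹ ⊕ c) ⊕ ((h ⊕ c) ⊕ g′)))
                       G.refl h (r ⁻¹) c g′ ⟩
            (r ⁻¹ ∙ c) ∙ (b ∙ g′)
              ≈⟨ G.∙-congˡ (G.trans bg′≈tg (G.∙-congʳ (G.sym (\\-leftDividesˡ h t)))) ⟩
            (r ⁻¹ ∙ c) ∙ (h ∙ r ∙ g)
              ≈⟨ solve 5 (λ r⁻¹ c h r g → ((r⁻¹ ⊕ c) ⊕ ((h ⊕ r) ⊕ g)) ⊜ ((r⁻¹ ⊕ r) ⊕ ((h ⊕ c) ⊕ g)))
                       G.refl (r ⁻¹) c h r g ⟩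
            (r ⁻¹ ∙ r) ∙ (b ∙ g)
              ≈⟨ G.trans (G.∙-congʳ (G.inverseˡ r)) (G.identityˡ _) ⟩
            b ∙ g ∎))
        -- Chosen so that xt = yr, the form to which `reflect` applies.
        where r = h ⁻¹ ∙ t

      -- Within a coset σ replaces the connection element t by its inverse, again in S; edges
      -- between the cosets are handled by `cross`.
      rotate : ∀ u w → Γ.Adj (θ u) (θ w) → Γ.Adj (θ (u E.∙ √)) (θ (w E.∙ √))
      rotate (0ℙ , g) (0ℙ , g′) ((0ℙ , t) , t∈S , _ , g′≈tg) =
        adj-resp (D.sym (√-image₀ g)) (D.sym (√-image₀ g′))
          ( (0ℙ , t ⁻¹) , S.⁻¹-closed t∈S , ≡.refl
          , (begin
              b ∙ g′            ≈⟨ G.∙-congˡ g′≈tg ⟩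
              b ∙ (t ∙ g)       ≈⟨ solve 3 (λ b t g → (b ⊕ (t ⊕ g)) ⊜ (t ⊕ (b ⊕ g))) G.refl b t g ⟩
              -- Moving an element of G past x inverts it, so on xG left multiplication by `t ⁻¹`
              -- contributes `t ⁻¹ ⁻¹`.
              t ∙ (b ∙ g)       ≈⟨ G.∙-congʳ (GroupProperties.⁻¹-involutive G.group t) ⟨
              t ⁻¹ ⁻¹ ∙ (b ∙ g) ∎))
      rotate (1ℙ , g) (1ℙ , g′) ((0ℙ , t) , t∈S , _ , bg′≈t⁻¹bg) =
        adj-resp (D.sym (√-image₁ g)) (D.sym (√-image₁ g′))
          ( (0ℙ , t ⁻¹) , S.⁻¹-closed t∈S , ≡.refl
          , G.trans (G.∙-congʳ g′≈t⁻¹g) (G.assoc _ _ _))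
        where
        g′≈t⁻¹g : g′ ≈ t ⁻¹ ∙ g
        g′≈t⁻¹g = GroupProperties.∙-cancelˡ G.group b g′ (t ⁻¹ ∙ g) (G.trans bg′≈t⁻¹bg
          (solve 3 (λ t⁻¹ b g → (t⁻¹ ⊕ (b ⊕ g)) ⊜ (b ⊕ (t⁻¹ ⊕ g))) G.refl (t ⁻¹) b g))
      rotate (0ℙ , g) (1ℙ , g′) uw =
        adj-resp (D.sym (√-image₀ g)) (D.sym (√-image₁ g′)) (cross g g′ uw)
      rotate (1ℙ , g) (0ℙ , g′) uw =
        adj-resp (D.sym (√-image₁ g)) (D.sym (√-image₀ g′))
          (Γ.Adj-sym (cross g′ g (Γ.Adj-sym uw)))

    -- The extension is generated by G and σ: translation by σk is translation by σ followed by
    -- translation by k.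
    extension-translate : let open Inverse extension↔dihedral using (to) in ∀ t {u w} →
      Γ.Adj (to u) (to w) → Γ.Adj (to (u E.∙ t)) (to (w E.∙ t))
    extension-translate (0ℙ , k) {u} {w} uw = translate-embed k {u} {w} uw
    extension-translate (1ℙ , k) {u} {w} uw =
      adj-resp (θ-cong (split u)) (θ-cong (split w))
        (translate-embed k {u E.∙ √} {w E.∙ √} (rotate u w uw))
      where
      split : ∀ v → v E.∙ √ E.∙ embed k E.≈ v E.∙ (1ℙ , k)
      split v = E.trans (E.assoc v √ (embed k)) (E.∙-congˡ {v} (√∙embed k))

-- The regular action of the cyclic group times A on Γ.

theorem2p6 : ∀ {a ℓ s p : Level}
    (G : AbelianGroup a ℓ) →
    let module G = AbelianGroup G
        module D = Group (Dih G)
    in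
    Finite G.setoid →
    (S : InverseClosedSubset (Dih G) s) →
    let S∩xG = InverseClosedSubset.Member S ∩ xG G in
    (k : ℕ) (c : G.Carrier) (A : Subgroup G.group p) →
    HasOrder G.group c (2 ^ k) →
    IsInternalDirectProduct G (⟨_⟩ G.group c) A →
    (∃[ y ] y ∈ xG G ×
      (∀ g → (y D.∙ ι G g) ∈ S∩xG ⇔ ((y D.∙ ι G (g G.⁻¹)) D.∙ ι G c) ∈ S∩xG)) →
    IsCayleyGraphOn (Cay (Dih G) S)
      (AbelianGroup.group (CyclicGroup (2 ^ suc k) ×ᴳ subgroupAbelianGroup G A))
-- Elements of xG have parity `1ℙ`, so y = xh with h in G.
theorem2p6 G _ S k c A order direct ((0ℙ , h) , (_ , () , _) , _)
theorem2p6 G _ S k c A order direct ((1ℙ , h) , _ , y-reflects) = isCayley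
  where
  module G = AbelianGroup G

  reflect : ∀ g → (1ℙ , h G.∙ g) ∈ InverseClosedSubset.Member S →
            (1ℙ , h G.∙ g G.⁻¹ G.∙ c) ∈ InverseClosedSubset.Member S
  -- The product of y and g computes to `(1ℙ , h G.∙ g)`; its membership in xG is witnessed by
  -- `h G.∙ g`.
  reflect g hg∈S = proj₁ (Equivalence.to (y-reflects g)
    (hg∈S , h G.∙ g , ≡.refl , G.sym (G.identityˡ _)))

  isCayley = regular-≅⇒IsCayleyGraphOn (Cay (Dih G) S)
    (AbelianGroup.group (CyclicGroup (2 ^ suc k) ×ᴳ subgroupAbelianGroup G A))
    (AbelianGroup.group (SquareRootExtension.extension G c))
    (cyclic×subgroup↔extension G k c A order direct)
    (cyclic×subgroup-homo G k c A order direct)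
    (extension↔dihedral G S h c)
    (λ t {u} {w} → extension-translate G S h c reflect t {u} {w})
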